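{- For the $t$-fold wheel graph $W_{t,n}$, the multiset partition dimension is infinite: $\mathrm{mpd}(W_{t,n})=\infty$.
   Context: A $t$-fold wheel graph $W_{t,n}$ is a graph derived from a wheel (a cycle on $n$ vertices, called the rim, together with a hub vertex adjacent to all rim vertices) by duplicating the hub vertex one or more times, resulting in $t$ hub vertices, each adjacent to all rim vertices, and not adjacent to each other. $d(u,v)$ denotes the shortest-path distance. Let $G$ be a graph and let $\Pi=\{S_1,\dots,S_k\}$ be a partition of $V(G)$. For $v\in V(G)$ put $d(v,S_i)=\min\{d(v,x):x\in S_i\}$. The multiset partition representation of $v$ with respect to $\Pi$ is the multiset $r_{mp}(v\mid\Pi)=\{d(v,S_1),\dots,d(v,S_k)\}$ (order ignored, multiplicities kept). $\Pi$ is a resolving multiset partition if $r_{mp}(u\mid\Pi)\ne r_{mp}(v\mid\Pi)$ for all distinct $u,v\in V(G)$. The multiset partition dimension $\mathrm{mpd}(G)$ is the minimum number $k$ of parts of a resolving multiset partition of $G$, and $\mathrm{mpd}(G)=\infty$ if no resolving multiset partition exists. -}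

module Defs where

open import Level using (0ℓ)
open import Data.Nat.Base using (ℕ; zero; suc; _+_; _∸_; _≤_; _<_; s≤s)
import Data.Nat.Properties as ℕ
open import Data.Nat.Induction using (<-rec)
open import Data.Fin.Base using (Fin; zero; suc; toℕ; splitAt)
import Data.Fin.Properties as Fin
open import Data.Fin.Subset using (Subset; _∈_; Nonempty; Empty; _∩_)
open import Data.Fin.Subset.Properties using (_∈?_)
open import Data.List.Base using (List; map; filter; allFin; upTo)
open import Data.List.Extrema
import Data.List.Relation.Unary.All as All
import Data.List.Membership.Propositional as List
open import Data.List.Membership.Propositional.Properties
  using (∈-map⁺; ∈-map⁻; ∈-filter⁺; ∈-filter⁻; ∈-upTo⁺)
open import Data.List.Relation.Binary.Permutation.Propositional using (_↭_)
open import Data.Product using (∃; Σ; _×_; _,_)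
open import Data.Sum.Base using (_⊎_; inj₁; inj₂; swap)
open import Data.Empty using (⊥)
open import Data.Unit.Base using (⊤; tt)
open import Relation.Binary.Core using (Rel)
open import Relation.Binary.Bundles using (TotalOrder)
open import Relation.Binary.Definitions using (Decidable; Symmetric; Irreflexive)
open import Relation.Binary.PropositionalEquality
  using (_≡_; _≢_; refl; sym; trans; cong; subst)
open import Relation.Binary.Construct.Add.Supremum.NonStrict (_≤_)
  using (_≤⁺_; [_]; ≤⁺-isTotalOrder-≡)
open import Relation.Nullary using (Dec; ¬_; yes; no)
open import Relation.Nullary.Decidable using (map′; _×-dec_; _⊎-dec_)
open import Relation.Nullary.Construct.Add.Supremum using (_⁺; ⊤⁺; [_])

ℕ∞ : Set
ℕ∞ = ℕ ⁺

∞ : ℕ∞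
∞ = ⊤⁺

≤∞-totalOrder : TotalOrder 0ℓ 0ℓ 0ℓ
≤∞-totalOrder = record { isTotalOrder = ≤⁺-isTotalOrder-≡ ℕ.≤-isTotalOrder }

minimum : List ℕ∞ → ℕ∞
minimum = min ≤∞-totalOrder ∞

minimum-sel : ∀ xs → minimum xs ≡ ∞ ⊎ minimum xs List.∈ xs
minimum-sel = argmin-sel ≤∞-totalOrder (λ x → x) ∞

minimum-≤ : ∀ {x xs} → x List.∈ xs → minimum xs ≤⁺ x
minimum-≤ {xs = xs} = All.lookup (f[argmin]≤f[xs] ≤∞-totalOrder {f = λ x → x} ∞ xs)

record Graph (N : ℕ) : Set₁ where
  field
    Adj     : Rel (Fin N) 0ℓ
    adj?    : Decidable Adj
    symm    : Symmetric Adj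
    irrefl  : Irreflexive _≡_ Adj

module _ {N : ℕ} (G : Graph N) where
  open Graph G

  data Walk : Fin N → Fin N → ℕ → Set where
    []  : ∀ {u} → Walk u u 0
    _∷_ : ∀ {u v w l} → Adj u v → Walk v w l → Walk u w (suc l)

  walk? : ∀ u v → (l : ℕ) → Dec (Walk u v l)
  walk? u v zero    = map′ (λ { refl → [] }) (λ { [] → refl }) (u Fin.≟ v)
  walk? u v (suc l) =
    map′ (λ { (_ , a , p) → a ∷ p }) (λ { (a ∷ p) → _ , a , p })
         (Fin.any? (λ x → adj? u x ×-dec walk? x v l))

  -- Only lengths below N need to be inspected: a shortest walk does not repeat
  -- a vertex.  See dist-attained and dist-least below.
  lengths : Fin N → Fin N → List ℕ∞
  lengths u v = map [_] (filter (walk? u v) (upTo N))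

  dist : Fin N → Fin N → ℕ∞
  dist u v = minimum (lengths u v)

  distToSet : Fin N → Subset N → ℕ∞
  distToSet v S = minimum (map (dist v) (filter (_∈? S) (allFin N)))

  dist-attained : ∀ {u v l} → dist u v ≡ [ l ] → Walk u v l
  dist-attained {u} {v} eq
    with minimum-sel (lengths u v)
  ... | inj₁ ≡∞ with () ← trans (sym eq) ≡∞
  ... | inj₂ ∈xs
    with _ , l∈ , refl ← ∈-map⁻ [_] (subst (List._∈ lengths u v) eq ∈xs)
    with _ , p ← ∈-filter⁻ (walk? u v) {xs = upTo N} l∈ = p

  private
    _++_ : ∀ {u v w k l} → Walk u v k → Walk v w l → Walk u w (k + l)
    []      ++ q = q
    (a ∷ p) ++ q = a ∷ (p ++ q)

    vertex : ∀ {u v l} → Walk u v l → Fin (suc l) → Fin N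
    vertex {u} _       zero    = u
    vertex     (_ ∷ p) (suc i) = vertex p i

    takeWalk : ∀ {u v l} (p : Walk u v l) i → Walk u (vertex p i) (toℕ i)
    takeWalk _       zero    = []
    takeWalk (a ∷ p) (suc i) = a ∷ takeWalk p i

    dropWalk : ∀ {u v l} (p : Walk u v l) i → Walk (vertex p i) v (l ∸ toℕ i)
    dropWalk p       zero    = p
    dropWalk (_ ∷ p) (suc i) = dropWalk p i

    shorten : ∀ {u v l} → N ≤ l → Walk u v l → ∃ λ k → k < l × Walk u v k
    shorten {u} {v} {l} N≤l p
      with i , j , i<j , eq ← Fin.pigeonhole (s≤s N≤l) (vertex p) =
        toℕ i + (l ∸ toℕ j)
      , subst (toℕ i + (l ∸ toℕ j) <_) (ℕ.m+[n∸m]≡n (ℕ.≤-pred (Fin.toℕ<n j)))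
              (ℕ.+-monoˡ-< (l ∸ toℕ j) i<j)
      , takeWalk p i ++ subst (λ x → Walk x v _) (sym eq) (dropWalk p j)

    short : ∀ {u v} l → Walk u v l → ∃ λ k → k < N × k ≤ l × Walk u v k
    short {u} {v} = <-rec _ λ l rec p → step l (λ {k} → rec {k}) p
      where
      step : ∀ l → (∀ {k} → k < l → Walk u v k → ∃ λ m → m < N × m ≤ k × Walk u v m) →
             Walk u v l → ∃ λ k → k < N × k ≤ l × Walk u v k
      step l rec p with l ℕ.<? N
      ... | yes l<N = l , l<N , ℕ.≤-refl , p
      ... | no  l≮N
        with k , k<l , q ← shorten (ℕ.≮⇒≥ l≮N) p
        with m , m<N , m≤k , r ← rec k<l q =
          m , m<N , ℕ.≤-trans m≤k (ℕ.<⇒≤ k<l) , r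

  dist-least : ∀ {u v l} → Walk u v l → dist u v ≤⁺ [ l ]
  dist-least {u} {v} {l} p with k , k<N , k≤l , q ← short l p =
    TotalOrder.trans ≤∞-totalOrder
      (minimum-≤ (∈-map⁺ [_] (∈-filter⁺ (walk? u v) (∈-upTo⁺ k<N) q)))
      [ k≤l ]

record Partition (N k : ℕ) : Set where
  field
    part     : Fin k → Subset N
    nonempty : ∀ i → Nonempty (part i)
    disjoint : ∀ {i j} → i ≢ j → Empty (part i ∩ part j)
    cover    : ∀ v → ∃ λ i → v ∈ part i

module _ {N : ℕ} (G : Graph N) where

  -- A multiset is a list considered up to _↭_.
  representation : ∀ {k} → Partition N k → Fin N → List ℕ∞
  representation {k} Π v = map (λ i → distToSet G v (part i)) (allFin k)
    where open Partition Π

  Resolving : ∀ {k} → Partition N k → Set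
  Resolving Π = ∀ {u v} → u ≢ v → ¬ (representation Π u ↭ representation Π v)

  HasResolvingPartition : ℕ → Set
  HasResolvingPartition k = Σ (Partition N k) Resolving

  -- MPD m says that the multiset partition dimension equals m.
  MPD : ℕ∞ → Set
  MPD [ k ] = HasResolvingPartition k × (∀ j → HasResolvingPartition j → k ≤ j)
  MPD ⊤⁺    = ∀ k → ¬ HasResolvingPartition k

module _ {n : ℕ} where

  Next : Rel (Fin n) 0ℓ
  Next i j = (suc (toℕ i) ≡ toℕ j) ⊎ (suc (toℕ i) ≡ n × toℕ j ≡ 0)

  CycleAdj : Rel (Fin n) 0ℓ
  CycleAdj i j = Next i j ⊎ Next j i

  next? : Decidable Next
  next? i j = (suc (toℕ i) ℕ.≟ toℕ j) ⊎-dec ((suc (toℕ i) ℕ.≟ n) ×-dec (toℕ j ℕ.≟ 0))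

  cycleAdj? : Decidable CycleAdj
  cycleAdj? i j = next? i j ⊎-dec next? j i

  next-irrefl : 3 ≤ n → ∀ i → ¬ Next i i
  next-irrefl _   i (inj₁ eq)         = ℕ.1+n≢n eq
  next-irrefl 3≤n i (inj₂ (eq , i≡0))
    with s≤s () ← subst (3 ≤_) (trans (sym eq) (cong suc i≡0)) 3≤n

-- inj₁ marks a hub, inj₂ a rim vertex.
WheelAdj : ∀ {t n} → Rel (Fin t ⊎ Fin n) 0ℓ
WheelAdj (inj₁ _) (inj₁ _) = ⊥
WheelAdj (inj₁ _) (inj₂ _) = ⊤
WheelAdj (inj₂ _) (inj₁ _) = ⊤
WheelAdj (inj₂ i) (inj₂ j) = CycleAdj i j

wheelAdj? : ∀ {t n} → Decidable (WheelAdj {t} {n})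
wheelAdj? (inj₁ _) (inj₁ _) = no λ ()
wheelAdj? (inj₁ _) (inj₂ _) = yes tt
wheelAdj? (inj₂ _) (inj₁ _) = yes tt
wheelAdj? (inj₂ i) (inj₂ j) = cycleAdj? i j

wheelAdj-sym : ∀ {t n} → Symmetric (WheelAdj {t} {n})
wheelAdj-sym {x = inj₁ _} {inj₂ _} _ = tt
wheelAdj-sym {x = inj₂ _} {inj₁ _} _ = tt
wheelAdj-sym {x = inj₂ _} {inj₂ _} a = swap a

wheelAdj-irrefl : ∀ {t n} → 3 ≤ n → (x : Fin t ⊎ Fin n) → ¬ WheelAdj x x
wheelAdj-irrefl 3≤n (inj₂ i) (inj₁ a) = next-irrefl 3≤n i a
wheelAdj-irrefl 3≤n (inj₂ i) (inj₂ a) = next-irrefl 3≤n i a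

-- The first t vertices are the hubs, the last n form the rim.
multiWheel : (t n : ℕ) → 3 ≤ n → Graph (t + n)
multiWheel t n 3≤n = record
  { Adj    = λ u v → WheelAdj (splitAt t u) (splitAt t v)
  ; adj?   = λ u v → wheelAdj? (splitAt t u) (splitAt t v)
  ; symm   = λ {u} {v} → wheelAdj-sym {x = splitAt t u} {splitAt t v}
  ; irrefl = λ { {u} refl → wheelAdj-irrefl 3≤n (splitAt t u) }
  }

{-# OPTIONS --safe #-}

-- Only diameter at most 2 and the absence of isolated vertices matter.  A
-- representation with k parts consists of one 0 and k - 1 entries from {1, 2},
-- so it is determined by its number of 1s, which is less than k.  A resolving
-- partition of N vertices therefore has k ≥ N, hence its parts are singletons.
-- But then each vertex is at distance 1 from the part of a neighbour, so the
-- number of 1s takes at most k - 1 values, contradicting N ≥ k.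

module Submission where

open import Data.Nat.Base using (ℕ; zero; suc; _+_; _≤_; z≤n; s≤s)
import Data.Nat.Properties as ℕ
open import Data.Fin.Base
  using (Fin; zero; suc; inject₁; splitAt; join; punchIn; punchOut)
open import Data.Fin.Properties
  using (_≟_; splitAt-join; injective⇒≤; punchInᵢ≢i; punchOut-injective)
open import Data.Fin.Subset using (_∈_; _∉_; Nonempty)
open import Data.Fin.Subset.Properties using (_∈?_; x∈p∩q⁺)
open import Data.List.Base
  using (List; []; _∷_; map; filter; replicate; tabulate; allFin)
open import Data.List.Properties using (map-tabulate)
import Data.List.Membership.Propositional as List
open import Data.List.Membership.Propositional.Properties
  using (∈-map⁺; ∈-map⁻; ∈-filter⁺; ∈-filter⁻; ∈-allFin)
open import Data.List.Relation.Unary.All using (lookup)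
open import Data.List.Relation.Unary.All.Properties using (replicate⁺)
open import Data.List.Relation.Unary.Any using (tail)
open import Data.List.Relation.Binary.Permutation.Propositional
  using (_↭_; prep; swap; ↭-refl; ↭-reflexive; ↭-sym; ↭-trans)
open import Data.List.Relation.Binary.Permutation.Propositional.Properties
  using (∈-resp-↭)
open import Data.Product using (∃; _×_; _,_; proj₁; proj₂)
open import Data.Sum.Base using (_⊎_; inj₁; inj₂)
open import Data.Unit.Base using (tt)
open import Function.Base using (id; _∘_)
open import Function.Definitions using (Injective)
open import Relation.Binary.Bundles using (TotalOrder)
open import Relation.Binary.Construct.Add.Supremum.NonStrict (_≤_)
  using (_≤⁺_; [_])
open import Relation.Binary.PropositionalEquality
  using (_≡_; _≢_; refl; sym; trans; cong; subst)
open import Relation.Nullary using (contradiction)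
open import Relation.Nullary.Construct.Add.Supremum using ([_])
open import Relation.Nullary.Decidable using (decidable-stable)
open import Defs

module _ {a} {A : Set a} where

  -- Serves to bring the entry of a vertex's own part, the 0, to the front of its representation.
  tabulate-↭-punchIn : ∀ {m} (f : Fin (suc m) → A) i →
    tabulate f ↭ f i ∷ tabulate (f ∘ punchIn i)
  tabulate-↭-punchIn         f zero    = ↭-refl
  tabulate-↭-punchIn {suc m} f (suc i) =
    ↭-trans (prep _ (tabulate-↭-punchIn (f ∘ suc) i)) (swap _ _ ↭-refl)

  module _ (x y : A) where

    -- Normal form of a multiset of size `m` over `x` and `y`: the index counts the copies of `x`,
    -- so it ranges over `0` to `m`.
    blocks : ∀ m → Fin (suc m) → List A
    blocks m       zero    = replicate m y
    blocks (suc m) (suc i) = x ∷ blocks m i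

    -- The new `y` moves past every `x`; `inject₁` keeps the count of `x` while the length grows.
    ∷-blocks : ∀ m i → y ∷ blocks m i ↭ blocks (suc m) (inject₁ i)
    ∷-blocks m       zero    = ↭-refl
    ∷-blocks (suc m) (suc i) = ↭-trans (swap y x ↭-refl) (prep x (∷-blocks m i))

    tabulate-↭-blocks : ∀ {m} (f : Fin m → A) → (∀ i → f i ≡ x ⊎ f i ≡ y) →
      ∃ λ j → tabulate f ↭ blocks m j
    tabulate-↭-blocks {zero}  f f∈ = zero , ↭-refl
    tabulate-↭-blocks {suc m} f f∈
      with j , p ← tabulate-↭-blocks (f ∘ suc) (f∈ ∘ suc) | f∈ zero
    ... | inj₁ eq rewrite eq = suc j , prep x p
    ... | inj₂ eq rewrite eq = inject₁ j , ↭-trans (prep y p) (∷-blocks m j)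

    ∈-blocks : x ≢ y → ∀ {m j} → x List.∈ blocks m j → zero ≢ j
    ∈-blocks x≢y {m} x∈ refl = x≢y (lookup (replicate⁺ {P = _≡ y} m refl) x∈)

-- Deleting the missed value `i` with `punchOut` leaves an injection into `Fin n`.
injective⇒≤-avoiding : ∀ {m n} {f : Fin m → Fin (suc n)} {i} →
  Injective _≡_ _≡_ f → (∀ j → i ≢ f j) → m ≤ n
injective⇒≤-avoiding f-inj i≢f =
  injective⇒≤ (λ {j} {k} eq → f-inj (punchOut-injective (i≢f j) (i≢f k) eq))

section-injective : ∀ {m n} (p : Fin m → Fin n) (r : Fin n → Fin m) →
  (∀ i → p (r i) ≡ i) → Injective _≡_ _≡_ r
section-injective p r p∘r {i} {j} eq =
  trans (sym (p∘r i)) (trans (cong p eq) (p∘r j))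

section⇒injective : ∀ {m n} (p : Fin m → Fin n) (r : Fin n → Fin m) →
  (∀ i → p (r i) ≡ i) → m ≤ n → Injective _≡_ _≡_ p
section⇒injective {zero}  p r p∘r m≤n {()}
section⇒injective {suc m} p r p∘r m≤n {u} {v} eq =
  trans (sym (r∘p u)) (trans (cong r eq) (r∘p v))
  where
  r∘p : ∀ v → r (p v) ≡ v
  -- If `v` were `r j`, then `r (p v)` would be `v`. So a counterexample `v` is missed by the
  -- injection `r`, which forces `n < m`.
  r∘p v = decidable-stable (r (p v) ≟ v) λ r∘p≢ → ℕ.<⇒≱ m≤n
    (injective⇒≤-avoiding {f = r} {i = v} (section-injective p r p∘r)
      λ { j refl → r∘p≢ (cong r (p∘r j)) })

module _ {N : ℕ} (G : Graph N) where
  open Graph G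

  Diameter≤2 : Set
  Diameter≤2 = ∀ u v → ∃ λ l → l ≤ 2 × Walk G u v l

  NoIsolatedVertex : Set
  NoIsolatedVertex = ∀ u → ∃ (Adj u)

  distToSet-attained : ∀ {u S l} → distToSet G u S ≡ [ l ] → ∃ λ x → x ∈ S × Walk G u x l
  distToSet-attained {u} {S} eq with minimum-sel (map (dist G u) (filter (_∈? S) (allFin N)))
  ... | inj₁ ≡∞ with () ← trans (sym eq) ≡∞
  ... | inj₂ ∈xs
    with x , x∈ , eq′ ← ∈-map⁻ (dist G u) ∈xs =
      x , proj₂ (∈-filter⁻ (_∈? S) {xs = allFin N} x∈) , dist-attained G (trans (sym eq′) eq)

  distToSet-least : ∀ {u x S l} → x ∈ S → Walk G u x l → distToSet G u S ≤⁺ [ l ]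
  distToSet-least {u} {x} {S} x∈S w = TotalOrder.trans ≤∞-totalOrder
    (minimum-≤ (∈-map⁺ (dist G u) (∈-filter⁺ (_∈? S) (∈-allFin x) x∈S)))
    (dist-least G w)

  distToSet≢0 : ∀ {u S} → u ∉ S → distToSet G u S ≢ [ 0 ]
  distToSet≢0 u∉S eq with _ , u∈S , [] ← distToSet-attained eq = u∉S u∈S

  distToSet-∈ : ∀ {u S} → u ∈ S → distToSet G u S ≡ [ 0 ]
  distToSet-∈ {u} {S} u∈S with distToSet G u S | distToSet-least u∈S []
  ... | _ | [ z≤n ] = refl

  distToSet-adj : ∀ {u v S} → u ∉ S → v ∈ S → Adj u v → distToSet G u S ≡ [ 1 ]
  distToSet-adj {u} {S = S} u∉S v∈S a
    with distToSet G u S | distToSet≢0 {u} {S} u∉S | distToSet-least v∈S (a ∷ [])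
  ... | _ | ≢0 | [ z≤n ]     = contradiction refl ≢0
  ... | _ | _  | [ s≤s z≤n ] = refl

  -- A walk to a member of `S` bounds the distance by 2, which also excludes `∞`; `u ∉ S` excludes
  -- 0.
  distToSet-∉ : Diameter≤2 → ∀ {u S} → Nonempty S → u ∉ S →
    distToSet G u S ≡ [ 1 ] ⊎ distToSet G u S ≡ [ 2 ]
  distToSet-∉ diam {u} {S} (x , x∈S) u∉S
    with l , l≤2 , w ← diam u x
    with distToSet G u S | distToSet≢0 {u} {S} u∉S
       | TotalOrder.trans ≤∞-totalOrder (distToSet-least x∈S w) [ l≤2 ]
  ... | _ | ≢0 | [ z≤n ]           = contradiction refl ≢0
  ... | _ | _  | [ s≤s z≤n ]       = inj₁ refl
  ... | _ | _  | [ s≤s (s≤s z≤n) ] = inj₂ refl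

module _ {N k : ℕ} (Π : Partition N k) where
  open Partition Π

  partOf : Fin N → Fin k
  partOf v = proj₁ (cover v)

  representative : Fin k → Fin N
  representative i = proj₁ (nonempty i)

  partOf-unique : ∀ {v i} → v ∈ part i → partOf v ≡ i
  partOf-unique {v} {i} v∈ = decidable-stable (partOf v ≟ i) λ ≢i →
    disjoint ≢i (v , x∈p∩q⁺ (proj₂ (cover v) , v∈))

  partOf-representative : ∀ i → partOf (representative i) ≡ i
  partOf-representative i = partOf-unique (proj₂ (nonempty i))

  parts≤vertices : k ≤ N
  parts≤vertices = injective⇒≤ (section-injective partOf representative partOf-representative)

  partOf-injective : N ≤ k → Injective _≡_ _≡_ partOf
  partOf-injective = section⇒injective partOf representative partOf-representative

module _ {N : ℕ} (G : Graph N) (diam : Diameter≤2 G) where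
  open Graph G

  module _ {m : ℕ} (Π : Partition N (suc m)) where
    open Partition Π

    representation-↭ : ∀ u → ∃ λ j →
      representation G Π u ↭ [ 0 ] ∷ blocks [ 1 ] [ 2 ] m j
    representation-↭ u
      with j , p ← tabulate-↭-blocks [ 1 ] [ 2 ]
             (λ j → distToSet G u (part (punchIn (partOf Π u) j)))
             (λ j → distToSet-∉ G diam (nonempty _)
                      (λ u∈ → punchInᵢ≢i _ j (sym (partOf-unique Π u∈)))) =
      -- `allFin` is `tabulate id`, so the representation is `tabulate d`; the own part is then
      -- pulled out and its distance replaced by 0.
      j , ↭-trans (↭-reflexive (map-tabulate id d))
          (↭-trans (tabulate-↭-punchIn d (partOf Π u))
          (↭-trans (↭-reflexive (cong (_∷ tabulate (d ∘ punchIn (partOf Π u)))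
                                (distToSet-∈ G (proj₂ (cover u)))))
          (prep [ 0 ] p)))
      where
      d : Fin (suc m) → ℕ∞
      d i = distToSet G u (part i)

    -- The number of parts at distance 1, read off the normal form.
    ones : Fin N → Fin (suc m)
    ones = proj₁ ∘ representation-↭

    ones-injective : Resolving G Π → Injective _≡_ _≡_ ones
    ones-injective res {u} {v} eq = decidable-stable (u ≟ v) λ u≢v → res u≢v
      (↭-trans (proj₂ (representation-↭ u))
      (↭-trans (↭-reflexive (cong (λ j → [ 0 ] ∷ blocks [ 1 ] [ 2 ] m j) eq))
      (↭-sym (proj₂ (representation-↭ v)))))

    -- The part of `v` is at distance 1 from `u`, so a 1 occurs in the representation. It is not the
    -- leading 0, hence it lies in the block, which for index zero would hold only 2s.
    ones≢0 : ∀ {u v} → Adj u v → partOf Π u ≢ partOf Π v → zero ≢ ones u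
    ones≢0 {u} {v} a pu≢pv = ∈-blocks [ 1 ] [ 2 ] (λ ())
      (tail (λ ()) (∈-resp-↭ (proj₂ (representation-↭ u)) 1∈representation))
      where
      1∈representation : [ 1 ] List.∈ representation G Π u
      1∈representation = subst (List._∈ representation G Π u)
        (distToSet-adj G (pu≢pv ∘ partOf-unique Π) (proj₂ (cover v)) a)
        (∈-map⁺ (distToSet G u ∘ part) (∈-allFin (partOf Π v)))

diameter≤2⇒MPD≡∞ : ∀ {N} (G : Graph (suc N)) →
  Diameter≤2 G → NoIsolatedVertex G → MPD G ∞
diameter≤2⇒MPD≡∞ G diam neighbour zero    (Π , _) with () ← partOf Π zero
diameter≤2⇒MPD≡∞ G diam neighbour (suc m) (Π , res) =
  -- `suc m ≤ suc N` reads as `m < suc N`, while removing 0 from the range of `ones` gives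
  -- `suc N ≤ m`.
  ℕ.<⇒≱ (parts≤vertices Π) (injective⇒≤-avoiding ones-inj ones-avoids-0)
  where
  ones-inj : Injective _≡_ _≡_ (ones G diam Π)
  ones-inj = ones-injective G diam Π res

  partOf-inj : Injective _≡_ _≡_ (partOf Π)
  -- `ones` embeds the vertices into `Fin (suc m)`, so there are at least as many parts as vertices.
  partOf-inj = partOf-injective Π (injective⇒≤ ones-inj)

  ones-avoids-0 : ∀ u → zero ≢ ones G diam Π u
  -- A neighbour in the same part would equal `u`, against irreflexivity.
  ones-avoids-0 u = ones≢0 G diam Π a λ eq → Graph.irrefl G (partOf-inj eq) a
    where a = proj₂ (neighbour u)

module _ {t n : ℕ} where

  wheel-neighbour : (x : Fin (suc t) ⊎ Fin (suc n)) → ∃ (WheelAdj x)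
  wheel-neighbour (inj₁ _) = inj₂ zero , tt
  wheel-neighbour (inj₂ _) = inj₁ zero , tt

  -- Two rim vertices are joined through a hub even when adjacent or equal, since only an upper
  -- bound on walk length is wanted; two hubs are joined through a rim vertex.
  wheel-near : (x y : Fin (suc t) ⊎ Fin (suc n)) →
    WheelAdj x y ⊎ ∃ λ z → WheelAdj x z × WheelAdj z y
  wheel-near (inj₁ _) (inj₁ _) = inj₂ (inj₂ zero , tt , tt)
  wheel-near (inj₁ _) (inj₂ _) = inj₁ tt
  wheel-near (inj₂ _) (inj₁ _) = inj₁ tt
  wheel-near (inj₂ _) (inj₂ _) = inj₂ (inj₁ zero , tt , tt)

module _ (t n : ℕ) (3≤n : 3 ≤ suc n) where

  private
    vertex : Fin (suc t) ⊎ Fin (suc n) → Fin (suc t + suc n)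
    vertex = join (suc t) (suc n)

  multiWheel-noIsolatedVertex : NoIsolatedVertex (multiWheel (suc t) (suc n) 3≤n)
  multiWheel-noIsolatedVertex u with z , a ← wheel-neighbour (splitAt (suc t) u) =
    vertex z , subst (WheelAdj _) (sym (splitAt-join (suc t) (suc n) z)) a

  multiWheel-diameter≤2 : Diameter≤2 (multiWheel (suc t) (suc n) 3≤n)
  multiWheel-diameter≤2 u v with wheel-near (splitAt (suc t) u) (splitAt (suc t) v)
  ... | inj₁ a           = 1 , s≤s z≤n , a ∷ []
  ... | inj₂ (z , a , b) = 2 , ℕ.≤-refl ,
    -- The middle vertex is explicit because it cannot be inferred from its image under `splitAt`.
    _∷_ {v = vertex z}
      (subst (WheelAdj _) (sym (splitAt-join (suc t) (suc n) z)) a)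
      (subst (λ w → WheelAdj w (splitAt (suc t) v)) (sym (splitAt-join (suc t) (suc n) z)) b ∷ [])

theorem4p5 : (t n : ℕ) → 2 ≤ t → (3≤n : 3 ≤ n) → MPD (multiWheel t n 3≤n) ∞
theorem4p5 (suc t) (suc n) _ 3≤n = diameter≤2⇒MPD≡∞ (multiWheel (suc t) (suc n) 3≤n)
  (multiWheel-diameter≤2 t n 3≤n) (multiWheel-noIsolatedVertex t n 3≤n)
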